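{- There exists a peak-pit Condorcet domain on a set of $10$ alternatives that consists of exactly $1082$ linear orders.
   Context: Let $X_n=\{1,\dots,n\}$ be the set of alternatives and let $L(X_n)$ be the set of all linear orders (permutations, written from most to least preferred) on $X_n$. A domain is a subset $D\subseteq L(X_n)$; its size is $|D|$. A domain $D$ is a Condorcet domain if for every preference profile with an odd number of agents, each of whose preference orders belongs to $D$, the majority relation of the profile is transitive. Equivalently (Sen), for every triple $x<y<z$ in $X_n$ the restriction of $D$ to $\{x,y,z\}$ satisfies a never condition $iNj$ for some $i,j\in\{1,2,3\}$, where $iNj$ means: in the restriction to $\{x,y,z\}$ of every order of $D$, the $i$-th alternative of the triple (first $=x$, second $=y$, third $=z$) is never in the $j$-th position (first position = most preferred). A Condorcet domain is peak-pit if for every triple the restriction of the domain to the triple satisfies a never condition of the form $iN3$ or of the form $iN1$ for some $i\in\{1,2,3\}$. -}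

module Defs where

open import Data.Fin using (Fin; zero; suc; toℕ; _<_; _<?_; _≟_)
open import Data.Fin.Properties using (any?)
open import Data.List using (List; head; drop; filter; length)
open import Data.List.Membership.DecPropositional using (_∈?_)
import Data.List.Membership.Propositional as List
import Data.List.Relation.Unary.Unique.Propositional as List
open import Data.Maybe using (just)
open import Data.Nat as ℕ using (ℕ; _%_)
open import Data.Product using (∃-syntax; _×_)
open import Data.Sum using (_⊎_)
open import Data.Vec as Vec using (Vec; count; lookup; toList)
open import Data.Vec.Relation.Unary.Unique.Propositional using (Unique)
open import Function using (_⇔_)
open import Level using (0ℓ)
open import Relation.Binary using (Rel; Transitive)
open import Relation.Binary.PropositionalEquality using (_≡_)
open import Relation.Nullary using (¬_; Dec; _×-dec_)
open import Relation.Unary using (Pred; _∈_)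

-- A permutation of the n alternatives, written from most to least preferred.
-- The proof is irrelevant so that two orders with the same ranking are equal.
record LinearOrder (n : ℕ) : Set where
  constructor mkOrder
  field
    ranking : Vec (Fin n) n
    .unique : Unique ranking

open LinearOrder public

Prefers : ∀ {n} → LinearOrder n → Rel (Fin n) 0ℓ
Prefers P a b =
  ∃[ i ] ∃[ j ] i < j × lookup (ranking P) i ≡ a × lookup (ranking P) j ≡ b

prefers? : ∀ {n} (P : LinearOrder n) (a b : Fin n) → Dec (Prefers P a b)
prefers? P a b = any? λ i → any? λ j →
  (i <? j) ×-dec (lookup (ranking P) i ≟ a) ×-dec (lookup (ranking P) j ≟ b)

Domain : ℕ → Set₁
Domain n = Pred (LinearOrder n) 0ℓ

HasSize : ∀ {n} → Domain n → ℕ → Set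
HasSize {n} D k =
  ∃[ Ps ] List.Unique Ps × length Ps ≡ k × (∀ (P : LinearOrder n) → P ∈ D ⇔ P List.∈ Ps)

Profile : ℕ → ℕ → Set
Profile n m = Vec (LinearOrder n) m

support : ∀ {n m} → Profile n m → Fin n → Fin n → ℕ
support π a b = count (λ P → prefers? P a b) π

-- The strict majority relation; with an odd number of agents there are no ties
-- between distinct alternatives.
Majority : ∀ {n m} → Profile n m → Rel (Fin n) 0ℓ
Majority π a b = support π b a ℕ.< support π a b

IsCondorcet : ∀ {n} → Domain n → Set
IsCondorcet {n} D =
  ∀ {m} → m % 2 ≡ 1 → (π : Profile n m) → (∀ v → lookup π v ∈ D) → Transitive (Majority π)

restrict : ∀ {n} → LinearOrder n → List (Fin n) → List (Fin n)
restrict P S = filter (λ a → _∈?_ _≟_ a S) (toList (ranking P))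

-- Never D t i j is the never condition (i+1)N(j+1) on the triple t: indices
-- and positions count from zero.
Never : ∀ {n} → Domain n → Vec (Fin n) 3 → Fin 3 → Fin 3 → Set
Never D t i j =
  ∀ P → P ∈ D → ¬ (head (drop (toℕ j) (restrict P (toList t))) ≡ just (lookup t i))

IsPeakPit : ∀ {n} → Domain n → Set
IsPeakPit {n} D =
  ∀ (x y z : Fin n) → x < y → y < z →
  let t = x Vec.∷ y Vec.∷ z Vec.∷ Vec.[] in
  ∃[ i ] (Never D t i (suc (suc zero)) ⊎ Never D t i zero)

{-# OPTIONS --safe #-}

-- An order can be read as the chain of its initial segments (as sets), and "x is
-- placed when j elements of the triple are already there" is a statement about a single
-- step S ⊂ S ∪ {x} of that chain. So the maximal chains of a set family F that
-- contains no such step, for some x and some j ∈ {0, 2} on every triple, form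
-- a peak-pit domain. Its size is a path count; a computer search over families with
-- this property produced one with 56 sets and 1084 maximal chains.
--
-- Peak-pit domains are Condorcet because a never-top or never-bottom condition on
-- {a, b, c} turns into an implication between two pairwise preferences that every
-- voter satisfies, hence into an inequality between supports; for each of the
-- conditions the inequality lets the majority a over b or b over c pass to a over c,
-- or contradicts the two together.
module Submission where

open import Data.Bool.Properties as Bool using ()
open import Data.Empty using (⊥; ⊥-elim)
open import Data.Fin using (Fin; zero; suc; toℕ; _<_; _<?_; _≟_; punchOut)
open import Data.Fin.Properties using (all?; any?; <-cmp; <-asym; <-trans; <⇒≢; <⇒notInjective; punchOut-injective)
open import Data.Fin.Subset using (Subset; ⁅_⁆; _∪_) renaming (_∈_ to _∈ₛ_; _∉_ to _∉ₛ_; ⊥ to ∅)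
open import Data.Fin.Subset.Properties using (x∈p∪q⁻; x∈p∪q⁺; x∈⁅x⁆; x∈⁅y⁆⇒x≡y; ∉⊥) renaming (_∈?_ to _∈ₛ?_)
open import Data.List using (List; []; _∷_; head; drop; take; filter; length; map; concatMap; allFin)
open import Data.List.Properties using (filter-none; length-map; length-take)
import Data.List.Membership.DecPropositional as DecMembership
open import Data.List.Membership.Propositional using (_∈_; _∉_)
open import Data.List.Membership.Propositional.Properties using (∈-filter⁺; ∈-filter⁻; ∈-map⁻)
open import Data.List.Relation.Binary.Permutation.Propositional as ↭ using (_↭_; ↭-refl; ↭-sym; ↭-trans)
open import Data.List.Relation.Binary.Permutation.Propositional.Properties using (∈-resp-↭)
open import Data.List.Relation.Unary.All as All using (All; []; _∷_)
import Data.List.Relation.Unary.All.Properties as All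
open import Data.List.Relation.Unary.AllPairs as AllPairs using (AllPairs; []; _∷_)
import Data.List.Relation.Unary.AllPairs.Properties as AllPairs
open import Data.List.Relation.Unary.Any using (here; there)
open import Data.List.Relation.Unary.Unique.Propositional using (Unique)
import Data.List.Relation.Unary.Unique.Propositional.Properties as Unique
open import Data.Maybe using (just)
open import Data.Nat as ℕ using (ℕ; zero; suc; _+_; _%_; _/_; _≡ᵇ_; z≤n; s≤s)
import Data.Nat.Properties as ℕ
open import Data.Product using (∃-syntax; _×_; _,_; proj₁; proj₂)
open import Data.Sum as Sum using (_⊎_; inj₁; inj₂)
open import Data.Vec as V using (Vec; []; _∷_; lookup; toList)
import Data.Vec.Membership.Propositional.Properties as V
import Data.Vec.Properties as V
import Data.Vec.Relation.Unary.All as VAll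
import Data.Vec.Relation.Unary.All.Properties as VAll
import Data.Vec.Relation.Unary.AllPairs as VAllPairs
import Data.Vec.Relation.Unary.Unique.Propositional as V
import Data.Vec.Relation.Unary.Unique.Propositional.Properties as V
open import Function using (_∘_; id; mk⇔)
open import Level using (0ℓ)
open import Relation.Binary using (Rel; tri<; tri≈; tri>)
open import Relation.Binary.PropositionalEquality using (_≡_; _≢_; refl; sym; trans; cong; subst)
open import Relation.Nullary using (¬_; Dec; yes; no; contradiction; ¬?; _×-dec_; _→-dec_; _⊎-dec_)
open import Relation.Nullary.Decidable using (recompute; toWitness)
open import Relation.Unary using (Decidable)
open import Defs

private
  variable
    n k : ℕ

-- Linear orders

lookup-injective : (P : LinearOrder n) {i j : Fin n} →
  lookup (ranking P) i ≡ lookup (ranking P) j → i ≡ j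
-- The uniqueness proof `u` is irrelevant, so the equality it yields is recovered through the
-- decision `i ≟ j`.
lookup-injective (mkOrder _ u) {i} {j} eq = recompute (i ≟ j) (V.lookup-injective u i j eq)

-- Pigeonhole: if `a` were missed, punching it out of the values of the ranking would inject
-- `Fin (suc n)` into `Fin n`.
position : (P : LinearOrder n) (a : Fin n) → ∃[ i ] lookup (ranking P) i ≡ a
position {suc n} P a with any? (λ i → lookup (ranking P) i ≟ a)
... | yes found = found
... | no absent = contradiction
  (λ {i} {j} → lookup-injective P ∘ punchOut-injective (avoids i) (avoids j))
  (<⇒notInjective ℕ.≤-refl)
  where
  avoids : ∀ i → a ≢ lookup (ranking P) i
  avoids i eq = absent (i , sym eq)

prefers-asym : (P : LinearOrder n) {a b : Fin n} → Prefers P a b → ¬ Prefers P b a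
prefers-asym P (i , j , i<j , refl , refl) (i′ , j′ , i′<j′ , eq , eq′)
  with refl ← lookup-injective P eq | refl ← lookup-injective P eq′ = <-asym i<j i′<j′

prefers-irrefl : (P : LinearOrder n) {a : Fin n} → ¬ Prefers P a a
prefers-irrefl P p = prefers-asym P p p

prefers-trans : (P : LinearOrder n) {a b c : Fin n} → Prefers P a b → Prefers P b c → Prefers P a c
prefers-trans P (i , j , i<j , refl , refl) (i′ , j′ , i′<j′ , eq , refl)
  with refl ← lookup-injective P eq = i , j′ , <-trans i<j i′<j′ , refl , refl

prefers-total : (P : LinearOrder n) {a b : Fin n} → a ≢ b → Prefers P a b ⊎ Prefers P b a
prefers-total P {a} {b} a≢b with position P a | position P b
... | i , refl | j , refl with <-cmp i j
... | tri< i<j _ _ = inj₁ (i , j , i<j , refl , refl)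
... | tri≈ _ refl _ = contradiction refl a≢b
... | tri> _ _ j<i = inj₂ (j , i , j<i , refl , refl)

¬prefers⇒prefers : (P : LinearOrder n) {a b : Fin n} → a ≢ b → ¬ Prefers P a b → Prefers P b a
¬prefers⇒prefers P a≢b ¬ab = Sum.[ (λ ab → contradiction ab ¬ab) , id ] (prefers-total P a≢b)

allPairs-toList : ∀ {A : Set} {R : Rel A 0ℓ} (v : Vec A n) →
  (∀ {i j} → i < j → R (lookup v i) (lookup v j)) → AllPairs R (toList v)
allPairs-toList []      r = []
allPairs-toList (x ∷ v) r =
  VAll.toList⁺ (VAll.lookup⁻ λ _ → r ℕ.z<s) ∷ allPairs-toList v (r ∘ ℕ.s<s)

module _ (P : LinearOrder n) where

  restrict-sorted : ∀ t → AllPairs (Prefers P) (restrict P t)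
  restrict-sorted t = AllPairs.filter⁺ _
    (allPairs-toList (ranking P) λ i<j → _ , _ , i<j , refl , refl)

  ∈-restrict⁺ : ∀ {a t} → a ∈ t → a ∈ restrict P t
  ∈-restrict⁺ {a} a∈t with i , refl ← position P a =
    ∈-filter⁺ _ (V.∈-toList⁺ (V.∈-lookup i (ranking P))) a∈t

  ∈-restrict⁻ : ∀ {a t} → a ∈ restrict P t → a ∈ t
  ∈-restrict⁻ = proj₂ ∘ ∈-filter⁻ _ {xs = toList (ranking P)}

  module _ {x y z : Fin n} {t : List (Fin n)} (t↭ : t ↭ x ∷ y ∷ z ∷ []) where

    private
      sorted : AllPairs (Prefers P) (restrict P t)
      sorted = restrict-sorted t

      x∈ : x ∈ restrict P t
      x∈ = ∈-restrict⁺ (∈-resp-↭ (↭-sym t↭) (here refl))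

      y∈ : y ∈ restrict P t
      y∈ = ∈-restrict⁺ (∈-resp-↭ (↭-sym t↭) (there (here refl)))

      z∈ : z ∈ restrict P t
      z∈ = ∈-restrict⁺ (∈-resp-↭ (↭-sym t↭) (there (there (here refl))))

      ⊆xyz : ∀ {a} → a ∈ restrict P t → a ∈ x ∷ y ∷ z ∷ []
      ⊆xyz = ∈-resp-↭ t↭ ∘ ∈-restrict⁻

    -- The restriction is sorted by preference, so a head other than `x` would be `y` or `z` ranked
    -- above `x`. The triple is given only up to `↭`, so that `x` can be any of its three members.
    restrict-first : Prefers P x y → Prefers P x z → head (restrict P t) ≡ just x
    restrict-first x≻y x≻z with restrict P t | sorted | x∈ | ⊆xyz
    ... | p ∷ _ | _          | here refl | _ = refl
    ... | p ∷ _ | p≻ ∷ _     | there x∈′ | ⊆ with ⊆ (here refl)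
    ...   | here refl                 = refl
    ...   | there (here refl)         = contradiction x≻y (prefers-asym P (All.lookup p≻ x∈′))
    ...   | there (there (here refl)) = contradiction x≻z (prefers-asym P (All.lookup p≻ x∈′))

    -- Both `y` and `z` must come before `x`, and nothing else can. Since the length of the
    -- restriction is not known in advance, `go` excludes every index of `x` other than 2.
    restrict-last : Prefers P y x → Prefers P z x → y ≢ z → head (drop 2 (restrict P t)) ≡ just x
    restrict-last y≻x z≻x y≢z = go (restrict P t) sorted x∈ y∈ z∈ ⊆xyz
      where
      ¬x≻ : ∀ {a} → a ∈ x ∷ y ∷ z ∷ [] → ¬ Prefers P x a
      ¬x≻ (here refl)                 = prefers-irrefl P
      ¬x≻ (there (here refl))         = prefers-asym P y≻x
      ¬x≻ (there (there (here refl))) = prefers-asym P z≻x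

      other : ∀ {a} → a ∈ x ∷ y ∷ z ∷ [] → Prefers P a x → a ≡ y ⊎ a ≡ z
      other (here refl)                 x≻x = contradiction x≻x (prefers-irrefl P)
      other (there (here refl))         _   = inj₁ refl
      other (there (there (here refl))) _   = inj₂ refl

      -- Three elements in strictly descending preference cannot all come from the two values `y`
      -- and `z`.
      ¬three : ∀ {p q s} → p ≡ y ⊎ p ≡ z → q ≡ y ⊎ q ≡ z → s ≡ y ⊎ s ≡ z →
        Prefers P p q → Prefers P p s → ¬ Prefers P q s
      ¬three (inj₁ refl) (inj₁ refl) _           pq ps qs = prefers-irrefl P pq
      ¬three (inj₁ refl) (inj₂ refl) (inj₁ refl) pq ps qs = prefers-irrefl P ps
      ¬three (inj₁ refl) (inj₂ refl) (inj₂ refl) pq ps qs = prefers-irrefl P qs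
      ¬three (inj₂ refl) (inj₂ refl) _           pq ps qs = prefers-irrefl P pq
      ¬three (inj₂ refl) (inj₁ refl) (inj₂ refl) pq ps qs = prefers-irrefl P ps
      ¬three (inj₂ refl) (inj₁ refl) (inj₁ refl) pq ps qs = prefers-irrefl P qs

      go : ∀ r → AllPairs (Prefers P) r → x ∈ r → y ∈ r → z ∈ r →
        (∀ {a} → a ∈ r → a ∈ x ∷ y ∷ z ∷ []) → head (drop 2 r) ≡ just x
      go (_ ∷ _) _ (here refl) (here refl) _ _ = contradiction y≻x (prefers-irrefl P)
      go (_ ∷ _) (p≻ ∷ _) (here refl) (there y∈) _ ⊆ = contradiction (All.lookup p≻ y∈) (¬x≻ (⊆ (there y∈)))
      -- With `x` at index 1 only one place is left ahead of it, and `y` and `z` would have to share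
      -- it.
      go (_ ∷ _ ∷ _) _ (there (here refl)) (here refl) (here refl) _ = contradiction refl y≢z
      go (_ ∷ _ ∷ _) _ (there (here refl)) (there (here refl)) _ _ = contradiction y≻x (prefers-irrefl P)
      go (_ ∷ _ ∷ _) (_ ∷ q≻ ∷ _) (there (here refl)) (there (there y∈)) _ ⊆ =
        contradiction (All.lookup q≻ y∈) (¬x≻ (⊆ (there (there y∈))))
      go (_ ∷ _ ∷ _) _ (there (here refl)) _ (there (here refl)) _ = contradiction z≻x (prefers-irrefl P)
      go (_ ∷ _ ∷ _) (_ ∷ q≻ ∷ _) (there (here refl)) _ (there (there z∈)) ⊆ =
        contradiction (All.lookup q≻ z∈) (¬x≻ (⊆ (there (there z∈))))
      go (_ ∷ _ ∷ _ ∷ _) _ (there (there (here refl))) _ _ _ = refl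
      -- With `x` at index 3 or later, the first three entries are ranked above `x`, so each is `y`
      -- or `z`.
      go (_ ∷ _ ∷ _ ∷ _) ((p≻q ∷ p≻s ∷ p≻) ∷ (q≻s ∷ q≻) ∷ s≻ ∷ _) (there (there (there x∈))) _ _ ⊆ =
        contradiction q≻s (¬three
          (other (⊆ (here refl)) (All.lookup p≻ x∈))
          (other (⊆ (there (here refl))) (All.lookup q≻ x∈))
          (other (⊆ (there (there (here refl)))) (All.lookup s≻ x∈))
          p≻q p≻s)

-- Never conditions and majority

NeverTop NeverBottom : Domain n → Fin n → Fin n → Fin n → Set
NeverTop    D x y z = ∀ {P} → D P → ¬ (Prefers P x y × Prefers P x z)
NeverBottom D x y z = ∀ {P} → D P → ¬ (Prefers P y x × Prefers P z x)

NeverExtreme : Domain n → Fin n → Fin n → Fin n → Set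
NeverExtreme D x y z = NeverTop D x y z ⊎ NeverBottom D x y z

neverExtreme-swap : ∀ (D : Domain n) {x y z} → NeverExtreme D x y z → NeverExtreme D x z y
neverExtreme-swap _ = Sum.map (λ ¬top PD (xz , xy) → ¬top PD (xy , xz))
                              (λ ¬bot PD (zx , yx) → ¬bot PD (yx , zx))

-- Letting any of the three alternatives be the distinguished one makes the property invariant under
-- permutations of the triple.
SomeNeverExtreme : Domain n → Fin n → Fin n → Fin n → Set
SomeNeverExtreme D x y z = NeverExtreme D x y z ⊎ NeverExtreme D y x z ⊎ NeverExtreme D z x y

module _ (T : Fin n → Fin n → Fin n → Set)
  (swap₁₂ : ∀ {a b c} → T a b c → T b a c) (swap₂₃ : ∀ {a b c} → T a b c → T a c b)
  (increasing : ∀ {a b c} → a < b → b < c → T a b c) where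

  private
    ascending : ∀ {a b c} → a < b → b ≢ c → a ≢ c → T a b c
    ascending {a} {b} {c} a<b b≢c a≢c with <-cmp b c | <-cmp a c
    ... | tri< b<c _ _ | _            = increasing a<b b<c
    ... | tri≈ _ b≡c _ | _            = contradiction b≡c b≢c
    ... | tri> _ _ c<b | tri< a<c _ _ = swap₂₃ (increasing a<c c<b)
    ... | tri> _ _ c<b | tri≈ _ a≡c _ = contradiction a≡c a≢c
    ... | tri> _ _ c<b | tri> _ _ c<a = swap₂₃ (swap₁₂ (increasing c<a a<b))

  -- Adjacent transpositions generate all permutations of three elements, so the triple can be
  -- sorted.
  distinct-triple : ∀ {a b c} → a ≢ b → b ≢ c → a ≢ c → T a b c
  distinct-triple {a} {b} a≢b b≢c a≢c with <-cmp a b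
  ... | tri< a<b _ _ = ascending a<b b≢c a≢c
  ... | tri≈ _ a≡b _ = contradiction a≡b a≢b
  ... | tri> _ _ b<a = swap₁₂ (ascending b<a a≢c b≢c)

-- `IsPeakPit` speaks of increasing triples only, while in a majority chain a, b, c the alternatives
-- come in any order.
peakPit⇒someNeverExtreme : ∀ {D : Domain n} → IsPeakPit D →
  ∀ {a b c} → a ≢ b → b ≢ c → a ≢ c → SomeNeverExtreme D a b c
peakPit⇒someNeverExtreme {n} {D} peakPit = distinct-triple (SomeNeverExtreme D) swap₁₂ swap₂₃ increasing
  where
  swap₁₂ : ∀ {a b c} → SomeNeverExtreme D a b c → SomeNeverExtreme D b a c
  swap₁₂ (inj₁ a)        = inj₂ (inj₁ a)
  swap₁₂ (inj₂ (inj₁ b)) = inj₁ b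
  swap₁₂ (inj₂ (inj₂ c)) = inj₂ (inj₂ (neverExtreme-swap D c))

  swap₂₃ : ∀ {a b c} → SomeNeverExtreme D a b c → SomeNeverExtreme D a c b
  swap₂₃ (inj₁ a)        = inj₁ (neverExtreme-swap D a)
  swap₂₃ (inj₂ (inj₁ b)) = inj₂ (inj₂ b)
  swap₂₃ (inj₂ (inj₂ c)) = inj₂ (inj₁ c)

  neverExtreme : ∀ (t : Vec (Fin n) 3) i {y z} → toList t ↭ lookup t i ∷ y ∷ z ∷ [] → y ≢ z →
    Never D t i (suc (suc zero)) ⊎ Never D t i zero → NeverExtreme D (lookup t i) y z
  neverExtreme t i t↭ y≢z = Sum.[
    (λ ¬last  → inj₂ λ {P} PD (yx , zx) → ¬last P PD (restrict-last P t↭ yx zx y≢z)) ,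
    (λ ¬first → inj₁ λ {P} PD (xy , xz) → ¬first P PD (restrict-first P t↭ xy xz)) ]

  increasing : ∀ {a b c} → a < b → b < c → SomeNeverExtreme D a b c
  increasing {a} {b} {c} a<b b<c with peakPit a b c a<b b<c
  ... | zero , never =
    inj₁ (neverExtreme (a ∷ b ∷ c ∷ []) zero ↭-refl (<⇒≢ b<c) never)
  ... | suc zero , never =
    inj₂ (inj₁ (neverExtreme (a ∷ b ∷ c ∷ []) (suc zero) (↭.swap a b ↭-refl) (<⇒≢ (<-trans a<b b<c)) never))
  ... | suc (suc zero) , never =
    inj₂ (inj₂ (neverExtreme (a ∷ b ∷ c ∷ []) (suc (suc zero))
      (↭-trans (↭.prep a (↭.swap b c ↭-refl)) (↭.swap a c ↭-refl)) (<⇒≢ a<b) never))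

-- Implications between pairwise preferences, and majority

Implies : Domain n → Fin n → Fin n → Fin n → Fin n → Set
Implies D a b c d = ∀ {P} → D P → Prefers P a b → Prefers P c d

module _ {D : Domain n} where

  implies-contrapositive : ∀ {a b c d} → a ≢ b → Implies D a b c d → Implies D d c b a
  implies-contrapositive a≢b ab⇒cd {P} PD dc =
    ¬prefers⇒prefers P a≢b λ ab → prefers-asym P dc (ab⇒cd PD ab)

  -- If `x` beats `y`, then `x` not being on top forces `z` above `x`, hence above `y`.
  neverTop⇒implies : ∀ {x y z} → x ≢ z → NeverTop D x y z → Implies D x y z y
  neverTop⇒implies x≢z ¬top {P} PD xy =
    prefers-trans P (¬prefers⇒prefers P x≢z λ xz → ¬top PD (xy , xz)) xy

  -- If `x` is below `y`, then `x` not being at the bottom forces `z` below `x`, hence below `y`.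
  neverBottom⇒implies : ∀ {x y z} → z ≢ x → NeverBottom D x y z → Implies D y x y z
  neverBottom⇒implies z≢x ¬bot {P} PD yx =
    prefers-trans P yx (¬prefers⇒prefers P z≢x λ zx → ¬bot PD (yx , zx))

  support-mono : ∀ {m a b c d} (π : Profile n m) → (∀ v → D (lookup π v)) →
    Implies D a b c d → support π a b ℕ.≤ support π c d
  support-mono []      πD ab⇒cd = z≤n
  support-mono {a = a} {b} {c} {d} (P ∷ π) πD ab⇒cd
    with ih ← support-mono π (πD ∘ suc) ab⇒cd | prefers? P a b | prefers? P c d
  ... | yes ab | yes cd = s≤s ih
  ... | yes ab | no ¬cd = contradiction (ab⇒cd (πD zero) ab) ¬cd
  ... | no ¬ab | yes cd = ℕ.m≤n⇒m≤1+n ih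
  ... | no ¬ab | no ¬cd = ih

  module _ {m} (π : Profile n m) (πD : ∀ v → D (lookup π v)) {a b c : Fin n}
    (a≢b : a ≢ b) (b≢c : b ≢ c) (a≢c : a ≢ c)
    (ab : Majority π a b) (bc : Majority π b c) where

    open ℕ.≤-Reasoning

    private
      mono : ∀ {w x y z} → Implies D w x y z → support π w x ℕ.≤ support π y z
      mono = support-mono π πD

      -- The implication bounds the support for `a` over `c` from below, its contrapositive bounds
      -- the opposite support from above; `a` therefore beats `c` by at least the margin of `a` over
      -- `b`.
      via-ab : Implies D a b a c → Majority π a c
      via-ab ab⇒ac = begin-strict
        support π c a ≤⟨ mono (implies-contrapositive a≢b ab⇒ac) ⟩
        support π b a <⟨ ab ⟩
        support π a b ≤⟨ mono ab⇒ac ⟩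
        support π a c ∎

      via-bc : Implies D b c a c → Majority π a c
      via-bc bc⇒ac = begin-strict
        support π c a ≤⟨ mono (implies-contrapositive b≢c bc⇒ac) ⟩
        support π c b <⟨ bc ⟩
        support π b c ≤⟨ mono bc⇒ac ⟩
        support π a c ∎

      -- Here the implication and its contrapositive close the two majorities into a strict cycle of
      -- supports.
      incompatible : Implies D b c b a → ⊥
      incompatible bc⇒ba = ℕ.<-irrefl refl (begin-strict
        support π b c ≤⟨ mono bc⇒ba ⟩
        support π b a <⟨ ab ⟩
        support π a b ≤⟨ mono (implies-contrapositive b≢c bc⇒ba) ⟩
        support π c b <⟨ bc ⟩
        support π b c ∎)

    -- The six conditions fall into three pairs. `a` never top or `c` never bottom gives `bc ⇒ ba`,
    -- which excludes the two majorities together; `a` never bottom or `b` never top gives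
    -- `bc ⇒ ac`; `b` never bottom or `c` never top gives `ab ⇒ ac`.
    majority-trans : SomeNeverExtreme D a b c → Majority π a c
    majority-trans (inj₁ (inj₁ ¬top)) =
      ⊥-elim (incompatible (implies-contrapositive a≢b (neverTop⇒implies a≢c ¬top)))
    majority-trans (inj₁ (inj₂ ¬bot)) =
      via-bc (implies-contrapositive (a≢c ∘ sym)
        (neverBottom⇒implies (a≢b ∘ sym) λ PD (ca , ba) → ¬bot PD (ba , ca)))
    majority-trans (inj₂ (inj₁ (inj₁ ¬top))) =
      via-bc (neverTop⇒implies (a≢b ∘ sym) λ PD (bc , ba) → ¬top PD (ba , bc))
    majority-trans (inj₂ (inj₁ (inj₂ ¬bot))) = via-ab (neverBottom⇒implies (b≢c ∘ sym) ¬bot)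
    majority-trans (inj₂ (inj₂ (inj₁ ¬top))) =
      via-ab (implies-contrapositive (a≢c ∘ sym) (neverTop⇒implies (b≢c ∘ sym) ¬top))
    majority-trans (inj₂ (inj₂ (inj₂ ¬bot))) =
      ⊥-elim (incompatible (neverBottom⇒implies a≢c λ PD (bc , ac) → ¬bot PD (ac , bc)))

peakPit⇒condorcet : ∀ {D : Domain n} → IsPeakPit D → IsCondorcet D
peakPit⇒condorcet peakPit _ π πD {a} {b} {c} ab bc with a ≟ b | b ≟ c | a ≟ c
... | yes refl | _        | _        = contradiction ab (ℕ.<-irrefl refl)
... | no _     | yes refl | _        = contradiction bc (ℕ.<-irrefl refl)
... | no _     | no _     | yes refl = contradiction bc (ℕ.<-asym ab)
... | no a≢b   | no b≢c   | no a≢c   =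
  majority-trans π πD a≢b b≢c a≢c ab bc (peakPit⇒someNeverExtreme peakPit a≢b b≢c a≢c)

-- Traces of sets

-- If `S` is an initial segment of an order and `t` a triple, this is the position, counted from
-- zero, that the next element of `t` takes within the triple.
traceSize : List (Fin n) → Subset n → ℕ
traceSize t S = length (filter (_∈ₛ? S) t)

traceSize-∅ : ∀ (t : List (Fin n)) → traceSize t ∅ ≡ 0
traceSize-∅ t = cong length (filter-none (_∈ₛ? ∅) (All.universal (λ _ → ∉⊥) t))

traceSize-∉ : ∀ {a : Fin n} {t} S → a ∉ t → traceSize t (S ∪ ⁅ a ⁆) ≡ traceSize t S
traceSize-∉ {t = []}        S a∉t = refl
traceSize-∉ {a = a} {t = b ∷ t} S a∉t
  with ih ← traceSize-∉ {t = t} S (a∉t ∘ there) | b ∈ₛ? (S ∪ ⁅ a ⁆) | b ∈ₛ? S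
... | yes _  | yes _   = cong suc ih
... | yes b∈ | no b∉S  = Sum.[ (λ b∈S → contradiction b∈S b∉S) ,
                               (λ b∈a → contradiction (here (sym (x∈⁅y⁆⇒x≡y a b∈a))) a∉t) ] (x∈p∪q⁻ S _ b∈)
... | no b∉  | yes b∈S = contradiction (x∈p∪q⁺ (inj₁ b∈S)) b∉
... | no _   | no _    = ih

traceSize-∈ : ∀ {a : Fin n} {t} S → Unique t → a ∈ t → a ∉ₛ S →
  traceSize t (S ∪ ⁅ a ⁆) ≡ suc (traceSize t S)
traceSize-∈ {a = a} {.a ∷ t} S (a∉t ∷ _) (here refl) a∉S with a ∈ₛ? (S ∪ ⁅ a ⁆) | a ∈ₛ? S
... | yes _ | no _    = cong suc (traceSize-∉ S (λ a∈t → All.lookup a∉t a∈t refl))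
... | yes _ | yes a∈S = contradiction a∈S a∉S
... | no a∉ | _       = contradiction (x∈p∪q⁺ (inj₂ (x∈⁅x⁆ a))) a∉
traceSize-∈ {a = a} {b ∷ t} S (b∉t ∷ u) (there a∈t) a∉S
  with ih ← traceSize-∈ S u a∈t a∉S | b ∈ₛ? (S ∪ ⁅ a ⁆) | b ∈ₛ? S
... | yes _  | yes _   = cong suc ih
... | yes b∈ | no b∉S  = Sum.[ (λ b∈S → contradiction b∈S b∉S) ,
                               (λ b∈a → contradiction (x∈⁅y⁆⇒x≡y a b∈a) (All.lookup b∉t a∈t)) ] (x∈p∪q⁻ S _ b∈)
... | no b∉  | yes b∈S = contradiction (x∈p∪q⁺ (inj₁ b∈S)) b∉
... | no _   | no _    = ih

-- Maximal chains of a family of sets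

module Chains (F : List (Subset n)) where

  open DecMembership (V.≡-dec {n = n} Bool._≟_) using () renaming (_∈?_ to _∈F?_)

  Step : Subset n → Fin n → Set
  Step S a = a ∉ₛ S × S ∪ ⁅ a ⁆ ∈ F

  step? : ∀ S → Decidable (Step S)
  step? S a = ¬? (a ∈ₛ? S) ×-dec (S ∪ ⁅ a ⁆) ∈F? F

  -- A chain of sets is encoded by the elements added one at a time. Start and length are left free
  -- for induction; from `∅` with length `n` the vector is a full ranking.
  data Chain (S : Subset n) : Vec (Fin n) k → Set where
    []  : Chain S []
    _∷_ : ∀ {a} {v : Vec (Fin n) k} → Step S a → Chain (S ∪ ⁅ a ⁆) v → Chain S (a ∷ v)

  chain-avoids : ∀ {S} {v : Vec (Fin n) k} → Chain S v → VAll.All (_∉ₛ S) v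
  chain-avoids []       = VAll.[]
  chain-avoids (st ∷ c) = proj₁ st VAll.∷ VAll.map (_∘ x∈p∪q⁺ ∘ inj₁) (chain-avoids c)

  -- The sets only grow along a chain, so an element once added lies in every later set and cannot
  -- be added again.
  chain-unique : ∀ {S} {v : Vec (Fin n) k} → Chain S v → V.Unique v
  chain-unique []                 = VAllPairs.[]
  chain-unique (_∷_ {a = a} _ c) =
    VAll.map (λ { b∉ refl → b∉ (x∈p∪q⁺ (inj₂ (x∈⁅x⁆ a))) }) (chain-avoids c) VAllPairs.∷ chain-unique c

  chains : ∀ k → Subset n → List (Vec (Fin n) k)
  chains zero    S = [] ∷ []
  chains (suc k) S =
    concatMap (λ a → map (a ∷_) (chains k (S ∪ ⁅ a ⁆))) (filter (step? S) (allFin n))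

  chains-sound : ∀ k S → All (Chain S) (chains k S)
  chains-sound zero    S = [] ∷ []
  chains-sound (suc k) S = All.concat⁺ (All.map⁺ (All.map
    (λ st → All.map⁺ (All.map (st ∷_) (chains-sound k _)))
    (All.all-filter (step? S) (allFin n))))

  -- Branches with different first steps differ in the head; within a branch the tails differ by
  -- induction.
  chains-unique : ∀ k S → Unique (chains k S)
  chains-unique zero    S = [] ∷ []
  chains-unique (suc k) S = Unique.concat⁺
    (All.map⁺ (All.universal (λ a → Unique.map⁺ V.∷-injectiveʳ (chains-unique k _)) _))
    (AllPairs.map⁺ (AllPairs.map distinct-heads (Unique.filter⁺ (step? S) (Unique.allFin⁺ n))))
    where
    distinct-heads : ∀ {a b} → a ≢ b → ∀ {v : Vec (Fin n) (suc k)} →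
      ¬ (v ∈ map (a ∷_) (chains k (S ∪ ⁅ a ⁆)) × v ∈ map (b ∷_) (chains k (S ∪ ⁅ b ⁆)))
    distinct-heads a≢b (v∈a , v∈b) with ∈-map⁻ _ v∈a | ∈-map⁻ _ v∈b
    ... | _ , _ , refl | _ , _ , eq = a≢b (V.∷-injectiveˡ eq)

  orders : List (LinearOrder n)
  orders = All.reduce (λ {v} c → mkOrder v (chain-unique c)) (chains-sound n ∅)

  -- Forgetting the attached proofs gives back the enumerated vectors; this carries uniqueness,
  -- length and the chain property over to `orders`.
  rankings : ∀ {vs} (cs : All (Chain ∅) vs) →
    map ranking (All.reduce (λ {v} c → mkOrder v (chain-unique c)) cs) ≡ vs
  rankings []       = refl
  rankings (c ∷ cs) = cong (_ ∷_) (rankings cs)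

  orders-unique : Unique orders
  orders-unique = Unique.map⁻ (subst Unique (sym (rankings (chains-sound n ∅))) (chains-unique n ∅))

  orders-length : length orders ≡ length (chains n ∅)
  orders-length = trans (sym (length-map ranking orders)) (cong length (rankings (chains-sound n ∅)))

  orders-chain : All (Chain ∅ ∘ ranking) orders
  orders-chain = All.map⁻ (subst (All (Chain ∅)) (sym (rankings (chains-sound n ∅))) (chains-sound n ∅))

  -- Never conditions checked on single steps of the family

  Crosses : List (Fin n) → Fin n → ℕ → Subset n → Set
  Crosses t x j S = traceSize t S ≡ j × Step S x

  crosses? : ∀ t x j → Decidable (Crosses t x j)
  crosses? t x j S = (traceSize t S ℕ.≟ j) ×-dec step? S x

  open DecMembership (_≟_ {n}) using (_∈?_)

  -- S′ is the set of alternatives placed before x; the offset traceSize t S makes the induction go through.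
  chain-crosses : ∀ {t x j} {S} {v : Vec (Fin n) k} → Unique t → S ∈ F → Chain S v →
    head (drop j (filter (_∈? t) (toList v))) ≡ just x →
    ∃[ S′ ] S′ ∈ F × Crosses t x (traceSize t S + j) S′
  chain-crosses {j = zero}  u S∈F [] ()
  chain-crosses {j = suc _} u S∈F [] ()
  chain-crosses {t = t} {j = j} {S} u S∈F (_∷_ {a = a} st c) eq with a ∈? t
  chain-crosses {t = t} {j = j} {S} u S∈F (_∷_ {a = a} st c) eq | no a∉t
    with S′ , S′∈F , m , st′ ← chain-crosses {j = j} u (proj₂ st) c eq
    = S′ , S′∈F , trans m (cong (_+ j) (traceSize-∉ S a∉t)) , st′
  chain-crosses {j = zero} {S} u S∈F (st ∷ c) refl | yes a∈t
    = S , S∈F , sym (ℕ.+-identityʳ _) , st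
  chain-crosses {j = suc j} {S} u S∈F (st ∷ c) eq | yes a∈t
    with S′ , S′∈F , m , st′ ← chain-crosses {j = j} u (proj₂ st) c eq
    = S′ , S′∈F , trans m (trans (cong (_+ j) (traceSize-∈ S u a∈t (proj₁ st))) (sym (ℕ.+-suc _ j))) , st′

  -- A sufficient condition for `Never` that ranges over the sets of `F` instead of the far more
  -- numerous orders, which keeps the decision procedure small.
  NeverCrossed : Vec (Fin n) 3 → Fin 3 → Fin 3 → Set
  NeverCrossed t i j = All (λ S → ¬ Crosses (toList t) (lookup t i) (toℕ j) S) F

  neverCrossed? : ∀ t i j → Dec (NeverCrossed t i j)
  neverCrossed? t i j = All.all? (λ S → ¬? (crosses? (toList t) (lookup t i) (toℕ j) S)) F

  -- An order violating the never condition would contain a forbidden step; its chain starts at `∅`,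
  -- whose trace is 0, so the offset in `chain-crosses` vanishes.
  neverCrossed⇒never : ∅ ∈ F → ∀ {D : Domain n} → (∀ {P} → D P → Chain ∅ (ranking P)) →
    ∀ t i j → Unique (toList t) → NeverCrossed t i j → Never D t i j
  neverCrossed⇒never ∅∈F D⊆chains t i j u never P PD eq
    with S , S∈F , crosses ← chain-crosses {j = toℕ j} u ∅∈F (D⊆chains PD) eq =
    All.lookup never S∈F
      (subst (λ m → Crosses (toList t) (lookup t i) (m + toℕ j) S) (traceSize-∅ (toList t)) crosses)

  NeverCrossedExtremes : Set
  NeverCrossedExtremes = ∀ x y z → x < y → y < z → let t = x ∷ y ∷ z ∷ [] in
    ∃[ i ] (NeverCrossed t i (suc (suc zero)) ⊎ NeverCrossed t i zero)

  neverCrossedExtremes? : Dec NeverCrossedExtremes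
  neverCrossedExtremes? = all? λ x → all? λ y → all? λ z → (x <? y) →-dec (y <? z) →-dec
    let t = x ∷ y ∷ z ∷ [] in
    any? λ i → neverCrossed? t i (suc (suc zero)) ⊎-dec neverCrossed? t i zero

  chains-peakPit : ∅ ∈ F → NeverCrossedExtremes →
    ∀ {D : Domain n} → (∀ {P} → D P → Chain ∅ (ranking P)) → IsPeakPit D
  chains-peakPit ∅∈F crossings {D} D⊆chains x y z x<y y<z with i , c ← crossings x y z x<y y<z =
    i , Sum.map (never (suc (suc zero))) (never zero) c
    where
    t = x ∷ y ∷ z ∷ []

    never : ∀ j → NeverCrossed t i j → Never D t i j
    never j = neverCrossed⇒never ∅∈F D⊆chains t i j
      ((<⇒≢ x<y ∷ <⇒≢ (<-trans x<y y<z) ∷ []) ∷ (<⇒≢ y<z ∷ []) ∷ [] ∷ [])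

  -- Never conditions pass to subdomains, so surplus chains can be dropped.
  peakPit-of-size : ∅ ∈ F → NeverCrossedExtremes → ∀ {m l} → length (chains n ∅) ≡ l → m ℕ.≤ l →
    ∃[ D ] IsCondorcet {n} D × IsPeakPit D × HasSize D m
  peakPit-of-size ∅∈F crossings {m} count m≤l =
    (_∈ Ps) , peakPit⇒condorcet peakPit , peakPit ,
    Ps , Unique.take⁺ m orders-unique , size , λ _ → mk⇔ id id
    where
    Ps = take m orders

    peakPit : IsPeakPit (_∈ Ps)
    peakPit = chains-peakPit ∅∈F crossings (All.lookup (All.take⁺ m orders-chain))

    size : length Ps ≡ m
    size = trans (length-take m orders)
      (ℕ.m≤n⇒m⊓n≡m (subst (m ℕ.≤_) (sym (trans orders-length count)) m≤l))

-- The family on ten alternatives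

-- Bit a of the numeral tells whether a is in the set: the rightmost digit is alternative 0.
fromBits : ∀ n → ℕ → Subset n
fromBits zero    _ = []
fromBits (suc n) b = (b % 2 ≡ᵇ 1) ∷ fromBits n (b / 2)

-- The sets are listed by cardinality; sizes 0 to 10 occur 1, 4, 5, 5, 8, 10, 8, 6, 4, 4 and 1
-- times.
family : List (Subset 10)
family = map (fromBits 10) (
  0b0000000000 ∷ 0b0000000001 ∷ 0b0000000010 ∷ 0b0000001000 ∷ 0b0000010000 ∷ 0b0000000011 ∷
  0b0000000101 ∷ 0b0000000110 ∷ 0b0000001010 ∷ 0b0000011000 ∷ 0b0000000111 ∷ 0b0000001011 ∷
  0b0000011010 ∷ 0b0000111000 ∷ 0b0010011000 ∷ 0b0000001111 ∷ 0b0000011011 ∷ 0b0000100111 ∷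
  0b0000111010 ∷ 0b0001111000 ∷ 0b0010000111 ∷ 0b0010011010 ∷ 0b1010011000 ∷ 0b0000011111 ∷
  0b0000101111 ∷ 0b0000111011 ∷ 0b0001100111 ∷ 0b0001111010 ∷ 0b0010001111 ∷ 0b0010011011 ∷
  0b1010000111 ∷ 0b1010011010 ∷ 0b1110011000 ∷ 0b0000111111 ∷ 0b0001101111 ∷ 0b0001111011 ∷
  0b0010011111 ∷ 0b1010001111 ∷ 0b1010011011 ∷ 0b1110000111 ∷ 0b1110011010 ∷ 0b0001111111 ∷
  0b0010111111 ∷ 0b1000111111 ∷ 0b1010011111 ∷ 0b1110001111 ∷ 0b1110011011 ∷ 0b0011111111 ∷
  0b0101111111 ∷ 0b1010111111 ∷ 0b1110011111 ∷ 0b0111111111 ∷ 0b1011111111 ∷ 0b1110111111 ∷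
  0b1111011111 ∷ 0b1111111111 ∷ [])

open Chains family

neverCrossedExtremes : NeverCrossedExtremes
-- By evaluation: the decision procedure finds a condition for each of the 120 increasing triples.
neverCrossedExtremes = toWitness {a? = neverCrossedExtremes?} _

chains-count : length (chains 10 ∅) ≡ 1084
chains-count = refl

mainTheorem1 : ∃[ D ] IsCondorcet {10} D × IsPeakPit D × HasSize D 1082
-- `∅` is the first set listed, hence `here refl`; the 2 is the surplus of 1084 chains over the 1082
-- orders kept.
mainTheorem1 = peakPit-of-size (here refl) neverCrossedExtremes chains-count (ℕ.m≤m+n 1082 2)
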